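{- For each integer $t\ge 6$ there is a strongly connected digraph $H_t$ of order $n=t^2+1$ with minimum in-degree $3$ such that $0<\ell_s(H_t)=O(t)$; that is, there is an absolute constant $C$ such that for every integer $t\ge 6$ there exists a strongly connected digraph $H_t$ with $t^2+1$ vertices and minimum in-degree $3$ satisfying $0<\ell_s(H_t)\le C t$.
   Context: Digraphs are finite, with no loops and no parallel arcs (directed 2-cycles are allowed). The order of a digraph is its number of vertices. The in-degree of a vertex is the number of its in-neighbors. A digraph is strongly connected (strong) if for every pair $x,y$ of vertices there are directed paths from $x$ to $y$ and from $y$ to $x$. A subdigraph $T$ of a digraph $D$ is an out-tree if $T$ is an oriented tree with only one vertex of in-degree zero (called the root); if moreover $V(T)=V(D)$, then $T$ is called an out-branching of $D$. The leaves of $T$ are its vertices of out-degree zero in $T$. $\ell_s(D)$ denotes the maximum possible number of leaves in an out-branching of $D$, with $\ell_s(D)=0$ if $D$ has no out-branching. -}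

module Defs where

import Data.Bool.Properties as Bool
open import Data.Empty using (⊥-elim)
open import Data.Fin.Base using (Fin; zero; suc)
import Data.Fin.Properties as Fin
open import Data.Fin.Subset using (Subset; _∈_; ⊤; ∣_∣)
open import Data.Fin.Subset.Properties using (_∈?_; ∣p∣≤n; anySubset?)
open import Data.List.Base as List using (List; []; _∷_; _∷ʳ_; length)
open import Data.List.Membership.Propositional.Properties using (∈-lookup; ∈-allFin)
import Data.List.Membership.Propositional as ListMembership
open import Data.List.Relation.Unary.All as All using (All)
open import Data.List.Relation.Unary.AllPairs using (_∷_)
open import Data.List.Relation.Unary.Any using (here; there)
open import Data.List.Relation.Unary.Linked using (Linked; linked?)
open import Data.List.Relation.Unary.Unique.Propositional using (Unique)
open import Data.Nat.Base using (ℕ; zero; suc; _≤_; z≤n; s≤s)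
import Data.Nat.Properties as ℕ
open import Data.Product using (∃; ∃₂; ∃!; _×_; _,_; proj₁; proj₂)
open import Data.Sum.Base using (_⊎_; inj₁; inj₂)
open import Data.Vec.Base as Vec using (Vec; []; _∷_)
import Data.Vec.Properties as Vec
open import Function.Base using (_∘_)
open import Relation.Binary.Construct.Closure.Equivalence using (EqClosure)
open import Relation.Binary.Construct.Closure.ReflexiveTransitive using (Star; ε; _◅_; _◅◅_)
open import Relation.Binary.Construct.Closure.Symmetric using (SymClosure; fwd; bwd)
import Relation.Binary.Definitions as B
open import Relation.Binary.PropositionalEquality using (_≡_; refl; sym; cong; subst)
open import Relation.Nullary using (¬_; Dec; yes; no; does)
open import Relation.Nullary.Decidable using (map′; _×-dec_; _⊎-dec_; _→-dec_; ¬?)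
open import Relation.Unary using (Decidable)

import Data.List.Relation.Unary.Unique.DecPropositional as DecUnique

-- Row u is the set of out-neighbours of u, so parallel arcs cannot occur.
Arcs : ℕ → Set
Arcs n = Vec (Subset n) n

infix 4 _⊢_⟶_
_⊢_⟶_ : ∀ {n} → Arcs n → Fin n → Fin n → Set
A ⊢ u ⟶ v = v ∈ Vec.lookup A u

outNeighbours : ∀ {n} → Arcs n → Fin n → Subset n
outNeighbours A u = Vec.lookup A u

inNeighbours : ∀ {n} → Arcs n → Fin n → Subset n
inNeighbours A v = Vec.map (λ out → Vec.lookup out v) A

outDegree inDegree : ∀ {n} → Arcs n → Fin n → ℕ
outDegree A v = ∣ outNeighbours A v ∣
inDegree  A v = ∣ inNeighbours A v ∣

record Digraph (n : ℕ) : Set where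
  field
    arcs     : Arcs n
    loopless : ∀ v → ¬ (arcs ⊢ v ⟶ v)

open Digraph public

Strong : ∀ {n} → Digraph n → Set
Strong D = ∀ x y → Star (arcs D ⊢_⟶_) x y × Star (arcs D ⊢_⟶_) y x

HasMinInDegree : ∀ {n} → Digraph n → ℕ → Set
HasMinInDegree D d =
  (∀ v → d ≤ inDegree (arcs D) v) × ∃ λ v → inDegree (arcs D) v ≡ d

-- Candidate subdigraphs; being a subdigraph of a given D is the predicate _⊑_.
record Subgraph (n : ℕ) : Set where
  constructor subgraph
  field
    V : Subset n
    A : Arcs n

open Subgraph public

infix 4 _⊑_
_⊑_ : ∀ {n} → Subgraph n → Digraph n → Set
T ⊑ D = ∀ u v → A T ⊢ u ⟶ v → u ∈ V T × v ∈ V T × arcs D ⊢ u ⟶ v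

-- A closed walk v, vs, v in the underlying undirected graph whose vertices
-- are otherwise distinct; at least three vertices are required.
HasUndirectedCycle : ∀ {n} → Arcs n → Set
HasUndirectedCycle A = ∃₂ λ v vs →
  2 ≤ length vs × Unique (v ∷ vs) × Linked (SymClosure (A ⊢_⟶_)) (v ∷ (vs ∷ʳ v))

record IsOrientedTree {n} (T : Subgraph n) : Set where
  field
    oriented  : ∀ u v → A T ⊢ u ⟶ v → ¬ (A T ⊢ v ⟶ u)
    connected : ∀ u v → u ∈ V T → v ∈ V T → EqClosure (A T ⊢_⟶_) u v
    acyclic   : ¬ HasUndirectedCycle (A T)

record IsOutTree {n} (D : Digraph n) (T : Subgraph n) : Set where
  field
    subdigraph   : T ⊑ D
    orientedTree : IsOrientedTree T
    root         : ∃! _≡_ λ r → r ∈ V T × inDegree (A T) r ≡ 0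

record IsOutBranching {n} (D : Digraph n) (T : Subgraph n) : Set where
  field
    outTree  : IsOutTree D T
    spanning : V T ≡ ⊤

isLeaf? : ∀ {n} (T : Subgraph n) → Decidable (λ v → v ∈ V T × outDegree (A T) v ≡ 0)
isLeaf? T v = v ∈? V T ×-dec outDegree (A T) v ℕ.≟ 0

leaves : ∀ {n} → Subgraph n → Subset n
leaves T = Vec.tabulate (does ∘ isLeaf? T)

numLeaves : ∀ {n} → Subgraph n → ℕ
numLeaves T = ∣ leaves T ∣

HasOutBranchingWith : ∀ {n} → Digraph n → ℕ → Set
HasOutBranchingWith D k = ∃ λ T → IsOutBranching D T × numLeaves T ≡ k

-- The defining property of ℓₛ(D); ℓₛ below is the number satisfying it.
IsMaxLeaves : ∀ {n} → Digraph n → ℕ → Set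
IsMaxLeaves D k =
    (HasOutBranchingWith D k × (∀ T → IsOutBranching D T → numLeaves T ≤ k))
  ⊎ (¬ ∃ (IsOutBranching D) × k ≡ 0)

-- Reachability is decided by Warshall's algorithm: Via ks x y says that y is
-- reachable from x through intermediate vertices in ks.
module Reachability {n : ℕ} {R : Fin n → Fin n → Set} (R? : B.Decidable R) where

  open ListMembership using () renaming (_∈_ to _∈ₗ_)

  Via : List (Fin n) → Fin n → Fin n → Set
  Via []       x y = x ≡ y ⊎ R x y
  Via (k ∷ ks) x y = Via ks x y ⊎ (Via ks x k × Via ks k y)

  via? : ∀ ks → B.Decidable (Via ks)
  via? []       x y = x Fin.≟ y ⊎-dec R? x y
  via? (k ∷ ks) x y = via? ks x y ⊎-dec (via? ks x k ×-dec via? ks k y)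

  sound : ∀ ks {x y} → Via ks x y → Star R x y
  sound []       (inj₁ refl)    = ε
  sound []       (inj₂ r)       = r ◅ ε
  sound (k ∷ ks) (inj₁ p)       = sound ks p
  sound (k ∷ ks) (inj₂ (p , q)) = sound ks p ◅◅ sound ks q

  to-head : ∀ {k ks x} → Via (k ∷ ks) x k → Via ks x k
  to-head (inj₁ p)       = p
  to-head (inj₂ (p , _)) = p

  from-head : ∀ {k ks y} → Via (k ∷ ks) k y → Via ks k y
  from-head (inj₁ p)       = p
  from-head (inj₂ (_ , q)) = q

  join : ∀ ks {x y z} → z ∈ₗ ks → Via ks x z → Via ks z y → Via ks x y
  join (k ∷ ks) (here refl) p q = inj₂ (to-head p , from-head q)
  join (k ∷ ks) (there z∈) (inj₁ p) (inj₁ q) = inj₁ (join ks z∈ p q)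
  join (k ∷ ks) (there z∈) (inj₁ p) (inj₂ (q , q′)) = inj₂ (join ks z∈ p q , q′)
  join (k ∷ ks) (there z∈) (inj₂ (p , p′)) (inj₁ q) = inj₂ (p , join ks z∈ p′ q)
  join (k ∷ ks) (there z∈) (inj₂ (p , _)) (inj₂ (_ , q′)) = inj₂ (p , q′)

  base : ∀ ks {x y} → x ≡ y ⊎ R x y → Via ks x y
  base []       p = p
  base (k ∷ ks) p = inj₁ (base ks p)

  complete : ∀ {x y} → Star R x y → Via (List.allFin n) x y
  complete ε       = base _ (inj₁ refl)
  complete (r ◅ s) = join _ (∈-allFin _) (base _ (inj₂ r)) (complete s)

  star? : B.Decidable (Star R)
  star? x y = map′ (sound _) complete (via? (List.allFin n) x y)

lookup-injective : ∀ {X : Set} {xs : List X} → Unique xs →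
                   ∀ i j → List.lookup xs i ≡ List.lookup xs j → i ≡ j
lookup-injective (_ ∷ _) zero zero _ = refl
lookup-injective (p ∷ _) zero (suc j) eq = ⊥-elim (All.lookup p (∈-lookup j) eq)
lookup-injective (p ∷ _) (suc i) zero eq = ⊥-elim (All.lookup p (∈-lookup i) (sym eq))
lookup-injective (_ ∷ u) (suc i) (suc j) eq = cong suc (lookup-injective u i j eq)

unique-length≤ : ∀ {n} {xs : List (Fin n)} → Unique xs → length xs ≤ n
unique-length≤ {xs = xs} u =
  Fin.injective⇒≤ {f = List.lookup xs} (λ {i} {j} → lookup-injective u i j)

anyList? : ∀ {n} m {P : List (Fin n) → Set} → Decidable P →
           Dec (∃ λ xs → length xs ≤ m × P xs)
anyList? zero    P? = map′ (λ p → [] , z≤n , p) (λ { ([] , _ , p) → p }) (P? [])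
anyList? (suc m) P? = map′
  (λ { (inj₁ p) → [] , z≤n , p ; (inj₂ (x , xs , l , p)) → x ∷ xs , s≤s l , p })
  (λ { ([] , _ , p) → inj₁ p ; (x ∷ xs , s≤s l , p) → inj₂ (x , xs , l , p) })
  (P? [] ⊎-dec Fin.any? λ x → anyList? m (λ xs → P? (x ∷ xs)))

anyVec? : ∀ {n} m {P : Vec (Subset n) m → Set} → Decidable P → Dec (∃ P)
anyVec? zero    P? = map′ ([] ,_) (λ { ([] , p) → p }) (P? [])
anyVec? (suc m) P? = map′
  (λ { (x , xs , p) → x ∷ xs , p }) (λ { (x ∷ xs , p) → x , xs , p })
  (anySubset? λ x → anyVec? m (λ xs → P? (x ∷ xs)))

module _ {n : ℕ} where

  arc? : (A : Arcs n) → B.Decidable (A ⊢_⟶_)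
  arc? A u v = v ∈? Vec.lookup A u

  edge? : (A : Arcs n) → B.Decidable (SymClosure (A ⊢_⟶_))
  edge? A u v = map′ (λ { (inj₁ p) → fwd p ; (inj₂ p) → bwd p })
                     (λ { (fwd p) → inj₁ p ; (bwd p) → inj₂ p })
                     (arc? A u v ⊎-dec arc? A v u)

  hasUndirectedCycle? : Decidable (HasUndirectedCycle {n})
  hasUndirectedCycle? A = map′
    (λ { (v , vs , _ , p) → v , vs , p })
    (λ { (v , vs , p@(_ , u , _)) → v , vs , ℕ.≤-trans (ℕ.n≤1+n _) (unique-length≤ u) , p })
    (Fin.any? λ v → anyList? n λ vs →
      2 ℕ.≤? length vs ×-dec DecUnique.unique? Fin._≟_ (v ∷ vs)
        ×-dec linked? (edge? A) (v ∷ (vs ∷ʳ v)))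

  _⊑?_ : B.Decidable (_⊑_ {n})
  T ⊑? D = Fin.all? λ u → Fin.all? λ v → arc? (A T) u v →-dec
    (u ∈? V T ×-dec v ∈? V T ×-dec arc? (arcs D) u v)

  isOrientedTree? : Decidable (IsOrientedTree {n})
  isOrientedTree? T = map′
    (λ (o , c , a) → record { oriented = o ; connected = c ; acyclic = a })
    (λ t → let open IsOrientedTree t in oriented , connected , acyclic)
    ((Fin.all? λ u → Fin.all? λ v → arc? (A T) u v →-dec ¬? (arc? (A T) v u))
      ×-dec (Fin.all? λ u → Fin.all? λ v → u ∈? V T →-dec v ∈? V T →-dec star? u v)
      ×-dec ¬? (hasUndirectedCycle? (A T)))
    where open Reachability (edge? (A T)) using (star?)

  unique? : {P : Fin n → Set} → Decidable P → Dec (∃! _≡_ P)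
  unique? P? = map′
    (λ (x , p , f) → x , p , λ {y} → f y) (λ (x , p , f) → x , p , λ y → f {y})
    (Fin.any? λ x → P? x ×-dec Fin.all? λ y → P? y →-dec x Fin.≟ y)

  isOutTree? : (D : Digraph n) → Decidable (IsOutTree D)
  isOutTree? D T = map′
    (λ (s , o , r) → record { subdigraph = s ; orientedTree = o ; root = r })
    (λ t → let open IsOutTree t in subdigraph , orientedTree , root)
    (T ⊑? D ×-dec isOrientedTree? T
      ×-dec unique? (λ r → r ∈? V T ×-dec inDegree (A T) r ℕ.≟ 0))

  isOutBranching? : (D : Digraph n) → Decidable (IsOutBranching D)
  isOutBranching? D T = map′
    (λ (o , s) → record { outTree = o ; spanning = s })
    (λ b → let open IsOutBranching b in outTree , spanning)
    (isOutTree? D T ×-dec Vec.≡-dec Bool._≟_ (V T) ⊤)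

  hasOutBranchingWith? : (D : Digraph n) → Decidable (HasOutBranchingWith D)
  hasOutBranchingWith? D k = map′
    (λ { (V , A , p) → subgraph V A , p }) (λ { (subgraph V A , p) → V , A , p })
    (anySubset? λ V → anyVec? n λ A →
      isOutBranching? D (subgraph V A) ×-dec numLeaves (subgraph V A) ℕ.≟ k)

boundedMax : ∀ {P : ℕ → Set} → Decidable P → ∀ b → (∀ k → P k → k ≤ b) →
             (∃ λ k → P k × (∀ j → P j → j ≤ k)) ⊎ ¬ ∃ P
boundedMax P? b bound with P? b
boundedMax P? b bound | yes p = inj₁ (b , p , bound)
boundedMax {P} P? zero bound | no ¬p =
  inj₂ λ (k , p) → ¬p (subst P (ℕ.n≤0⇒n≡0 (bound k p)) p)
boundedMax {P} P? (suc b) bound | no ¬p = boundedMax P? b λ k p →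
  ℕ.≤-pred (ℕ.≤∧≢⇒< (bound k p) λ k≡ → ¬p (subst P k≡ p))

abstract
  maxLeaves-exists : ∀ {n} (D : Digraph n) → ∃ (IsMaxLeaves D)
  maxLeaves-exists {n} D
    with boundedMax (hasOutBranchingWith? D) n (λ { k (T , _ , refl) → ∣p∣≤n (leaves T) })
  ... | inj₁ (k , p , max) = k , inj₁ (p , λ T b → max (numLeaves T) (T , b , refl))
  ... | inj₂ none = 0 , inj₂ ((λ (T , b) → none (numLeaves T , T , b , refl)) , refl)

ℓₛ : ∀ {n} → Digraph n → ℕ
ℓₛ D = proj₁ (maxLeaves-exists D)

ℓₛ-isMaxLeaves : ∀ {n} (D : Digraph n) → IsMaxLeaves D (ℓₛ D)
ℓₛ-isMaxLeaves D = proj₂ (maxLeaves-exists D)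

{-# OPTIONS --safe #-}
module Submission where

-- Take t paths on t vertices, each containing all its backward arcs, and a hub
-- with an arc to the start of every path and an arc from the end of every path.
-- The vertices near the end of a path have too few in-neighbours; adding all
-- arcs among the last four vertices repairs this.  A path avoiding the
-- root of an out-branching can only be entered at its start, so it is traversed
-- in order up to its last three vertices and holds at most three leaves.  The path
-- of the root and the hub add at most t + 1 further leaves.

open import Defs
open import Data.Nat.Base using (ℕ; _≤_; _<_; _+_; _*_; _^_)
open import Data.Product using (∃; _×_)

open import Data.Bool.Base using (true; false)
open import Data.Empty using (⊥; ⊥-elim)
open import Data.Fin.Base as Fin using (Fin; zero; suc; toℕ; combine; remQuot)
open import Data.Fin.Patterns using (0F; 1F; 2F; 3F)
import Data.Fin.Properties as Fin
open import Data.Fin.Subset as Subset using (Subset; _∈_; _∪_; ⋃; ⁅_⁆; ∣_∣)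
open import Data.Fin.Subset.Properties
  using (∈⊤; nonempty?; Empty-unique; ∣⊥∣≡0; ∣⁅x⁆∣≡1; x∈p∧x∉q⇒x∈p─q;
         x∈⁅y⁆⇒x≡y; x∈⁅x⁆; x∈p∪q⁺; p⊆q⇒∣p∣≤∣q∣; x∈p⇒∣p-x∣<∣p∣; ∣p∣≤∣x∷p∣)
open import Data.List.Base using (List; []; _∷_; _++_; _∷ʳ_; length; map; allFin; cartesianProductWith)
import Data.List.Membership.DecPropositional as DecMembership
open import Data.List.Membership.Propositional using () renaming (_∈_ to _∈ₗ_)
open import Data.List.Membership.Propositional.Properties
  using (∈-map⁺; ∈-++⁺ˡ; ∈-++⁺ʳ; ∈-allFin; ∈-cartesianProductWith⁺)
open import Data.List.Properties using (length-map; length-++; length-tabulate)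
open import Data.List.Relation.Unary.All as All using (All; []; _∷_)
open import Data.List.Relation.Unary.All.Properties using (¬Any⇒All¬)
import Data.List.Relation.Unary.All.Properties as All
open import Data.List.Relation.Unary.AllPairs using ([]; _∷_)
open import Data.List.Relation.Unary.Any using (here; there)
open import Data.List.Relation.Unary.Linked as Linked using (Linked; [-]; _∷_)
open import Data.List.Relation.Unary.Unique.Propositional using (Unique)
import Data.List.Relation.Unary.Unique.Propositional.Properties as Unique
open import Data.Maybe.Base using (Maybe; just; nothing)
open import Data.Nat.Base using (zero; suc; z≤n; s≤s; _⊔_)
import Data.Nat.Properties as ℕ
open import Data.Product using (_,_; proj₁; proj₂)
open import Data.Sum.Base using (_⊎_; inj₁; inj₂)
open import Data.Vec.Base as Vec using ([]; _∷_)
import Data.Vec.Properties as Vec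
open import Function.Base using (_∘_; id)
import Relation.Binary.Construct.Closure.Equivalence as EqClosure
open import Relation.Binary.Construct.Closure.ReflexiveTransitive using (Star; ε; _◅_; _◅◅_; gmap)
open import Relation.Binary.Construct.Closure.Symmetric using (SymClosure; fwd; bwd)
import Relation.Binary.Definitions as B
open import Relation.Binary.PropositionalEquality
  using (_≡_; _≢_; refl; sym; trans; cong; subst; subst₂)
open import Relation.Nullary using (¬_; Dec; yes; no; does; contradiction)
open import Relation.Nullary.Decidable using (_×-dec_; ¬?; dec-true)

-- Counting finite subsets by lists, and arc sets given by decidable relations.

private
  variable
    n : ℕ
    p : Subset n

x∈p⇒0<∣p∣ : ∀ {x} → x ∈ p → 0 < ∣ p ∣
x∈p⇒0<∣p∣ x∈p = ℕ.≤-<-trans z≤n (x∈p⇒∣p-x∣<∣p∣ x∈p)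

∣p∣≢0⇒nonempty : ∣ p ∣ ≢ 0 → Subset.Nonempty p
∣p∣≢0⇒nonempty {n} {p} ≢0 with nonempty? p
... | yes ne = ne
... | no  em = contradiction (trans (cong ∣_∣ (Empty-unique em)) (∣⊥∣≡0 n)) ≢0

∣p∪q∣≤∣p∣+∣q∣ : ∀ (p q : Subset n) → ∣ p ∪ q ∣ ≤ ∣ p ∣ + ∣ q ∣
∣p∪q∣≤∣p∣+∣q∣ [] [] = z≤n
∣p∪q∣≤∣p∣+∣q∣ (false ∷ p) (false ∷ q) = ∣p∪q∣≤∣p∣+∣q∣ p q
∣p∪q∣≤∣p∣+∣q∣ (false ∷ p) (true  ∷ q) =
  ℕ.≤-trans (s≤s (∣p∪q∣≤∣p∣+∣q∣ p q)) (ℕ.≤-reflexive (sym (ℕ.+-suc ∣ p ∣ ∣ q ∣)))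
∣p∪q∣≤∣p∣+∣q∣ (true  ∷ p) (s     ∷ q) =
  s≤s (ℕ.≤-trans (∣p∪q∣≤∣p∣+∣q∣ p q) (ℕ.+-monoʳ-≤ ∣ p ∣ (∣p∣≤∣x∷p∣ s q)))

fromList : List (Fin n) → Subset n
fromList xs = ⋃ (map ⁅_⁆ xs)

∈-fromList : ∀ {x} {xs : List (Fin n)} → x ∈ₗ xs → x ∈ fromList xs
∈-fromList (here refl) = x∈p∪q⁺ (inj₁ (x∈⁅x⁆ _))
∈-fromList (there x∈)  = x∈p∪q⁺ (inj₂ (∈-fromList x∈))

∣fromList∣≤length : ∀ (xs : List (Fin n)) → ∣ fromList xs ∣ ≤ length xs
∣fromList∣≤length {n = n} [] = ℕ.≤-reflexive (∣⊥∣≡0 n)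
∣fromList∣≤length (x ∷ xs) = ℕ.≤-trans (∣p∪q∣≤∣p∣+∣q∣ ⁅ x ⁆ (fromList xs))
  (ℕ.+-mono-≤ (ℕ.≤-reflexive (∣⁅x⁆∣≡1 x)) (∣fromList∣≤length xs))

∣p∣≤length : ∀ xs → (∀ {x} → x ∈ p → x ∈ₗ xs) → ∣ p ∣ ≤ length xs
∣p∣≤length xs cover =
  ℕ.≤-trans (p⊆q⇒∣p∣≤∣q∣ (∈-fromList ∘ cover)) (∣fromList∣≤length xs)

length≤∣p∣ : ∀ {xs} → Unique xs → All (_∈ p) xs → length xs ≤ ∣ p ∣
length≤∣p∣ [] [] = z≤n
length≤∣p∣ (x≢ ∷ u) (x∈p ∷ xs⊆p) = ℕ.≤-trans
  (s≤s (length≤∣p∣ u (All.zipWith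
    (λ (y∈p , x≢y) → x∈p∧x∉q⇒x∈p─q y∈p (λ y∈⁅x⁆ → x≢y (sym (x∈⁅y⁆⇒x≡y _ y∈⁅x⁆))))
    (xs⊆p , x≢))))
  (x∈p⇒∣p-x∣<∣p∣ x∈p)

module _ {P : Fin n → Set} (P? : ∀ x → Dec (P x)) where

  ∈-tabulate⁺ : ∀ {x} → P x → x ∈ Vec.tabulate (does ∘ P?)
  ∈-tabulate⁺ {x} px = Vec.lookup⇒[]= x _ (trans (Vec.lookup∘tabulate _ x) (dec-true (P? x) px))

  ∈-tabulate⁻ : ∀ {x} → x ∈ Vec.tabulate (does ∘ P?) → P x
  ∈-tabulate⁻ {x} x∈ with P? x | trans (sym (Vec.lookup∘tabulate (does ∘ P?) x)) (Vec.[]=⇒lookup x∈)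
  ... | yes px | _ = px
  ... | no  _  | ()

module _ {R : Fin n → Fin n → Set} (R? : B.Decidable R) where

  abstract
    relArcs : Arcs n
    relArcs = Vec.tabulate λ u → Vec.tabulate λ v → does (R? u v)

    relArcs⁺ : ∀ {u v} → R u v → relArcs ⊢ u ⟶ v
    relArcs⁺ {u} {v} r =
      subst (v ∈_) (sym (Vec.lookup∘tabulate _ u)) (∈-tabulate⁺ (R? u) r)

    relArcs⁻ : ∀ {u v} → relArcs ⊢ u ⟶ v → R u v
    relArcs⁻ {u} {v} v∈ = ∈-tabulate⁻ (R? u) (subst (v ∈_) (Vec.lookup∘tabulate _ u) v∈)

∈-inNeighbours⁺ : ∀ (A : Arcs n) {u v} → A ⊢ u ⟶ v → u ∈ inNeighbours A v
∈-inNeighbours⁺ A {u} v∈ = Vec.lookup⇒[]= u _ (trans (Vec.lookup-map u _ A) (Vec.[]=⇒lookup v∈))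

∈-inNeighbours⁻ : ∀ (A : Arcs n) {u v} → u ∈ inNeighbours A v → A ⊢ u ⟶ v
∈-inNeighbours⁻ A {u} {v} u∈ =
  Vec.lookup⇒[]= v _ (trans (sym (Vec.lookup-map u _ A)) (Vec.[]=⇒lookup u∈))

-- Cycles from backward-closed sets of vertices.

-- Following in-neighbours backwards from x inside P, the walk must close up.
module _ {n} {A : Arcs n} (loopless : ∀ v → ¬ (A ⊢ v ⟶ v))
         (oriented : ∀ u v → A ⊢ u ⟶ v → ¬ (A ⊢ v ⟶ u)) where

  open DecMembership (Fin._≟_ {n}) using (_∈?_)

  -- The walk is cut where it meets `u`. The inclusion of `ys` in `xs` is carried along because it
  -- preserves distinctness in the recursion.
  closeWalk : ∀ {u x xs} → u ∈ₗ xs → Unique xs → Linked (A ⊢_⟶_) (x ∷ xs) →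
              ∃ λ ys → Linked (A ⊢_⟶_) (x ∷ (ys ∷ʳ u)) × Unique (u ∷ ys) ×
                       (∀ {y} → y ∈ₗ ys → y ∈ₗ xs)
  closeWalk (here refl) _ (e ∷ _) = [] , e ∷ [-] , [] ∷ [] , λ ()
  closeWalk {xs = y ∷ xs} (there u∈) (y≢ ∷ uniq) (e ∷ es)
    with ys , es′ , u≢ ∷ uniq′ , ys⊆ ← closeWalk u∈ uniq es =
    y ∷ ys , e ∷ es′ ,
    ((λ u≡y → All.lookup y≢ u∈ (sym u≡y)) ∷ u≢) ∷
      (All.tabulate (λ z∈ → All.lookup y≢ (ys⊆ z∈)) ∷ uniq′) ,
    λ { (here eq) → here eq ; (there z∈) → there (ys⊆ z∈) }

  -- A closed walk on one vertex would be a loop and one on two vertices a directed 2-cycle, so at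
  -- least three vertices remain.
  closedWalk⇒cycle : ∀ {u xs} → Linked (A ⊢_⟶_) (u ∷ (xs ∷ʳ u)) → Unique (u ∷ xs) →
                     HasUndirectedCycle A
  closedWalk⇒cycle {xs = []}        (e ∷ [-])      _ = contradiction e (loopless _)
  closedWalk⇒cycle {xs = _ ∷ []}    (e ∷ e′ ∷ [-]) _ = contradiction e′ (oriented _ _ e)
  closedWalk⇒cycle {xs = _ ∷ _ ∷ _} es uniq =
    _ , _ , s≤s (s≤s z≤n) , uniq , Linked.map fwd es

  module _ {P : Fin n → Set} (back : ∀ {v} → P v → ∃ λ u → P u × A ⊢ u ⟶ v) where

    extendWalk : ∀ m {x xs} → n < m + length (x ∷ xs) → P x → Unique (x ∷ xs) →
                 Linked (A ⊢_⟶_) (x ∷ xs) → HasUndirectedCycle A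
    -- `m` counts the extensions still allowed; once it is used up, the walk has more than `n`
    -- distinct vertices.
    extendWalk zero long _ uniq _ = contradiction (unique-length≤ uniq) (ℕ.<⇒≱ long)
    extendWalk (suc m) {x} {xs} long px uniq es with back px
    ... | u , pu , e with u ∈? (x ∷ xs)
    ...   | yes u∈ with ys , es′ , uniq′ , _ ← closeWalk u∈ uniq (e ∷ es) =
              closedWalk⇒cycle es′ uniq′
    ...   | no u∉ =
              extendWalk m (subst (n <_) (sym (ℕ.+-suc m _)) long) pu
                (¬Any⇒All¬ _ u∉ ∷ uniq) (e ∷ es)

    backwardClosed⇒cycle : ∀ {x} → P x → HasUndirectedCycle A
    backwardClosed⇒cycle px =
      extendWalk n (subst (n <_) (sym (ℕ.+-comm n 1)) ℕ.≤-refl) px ([] ∷ []) [-]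

-- Acyclicity of forests.

module _ {A : Arcs n} (height : Fin n → ℕ)
         (descending : ∀ {u v} → A ⊢ u ⟶ v → height v < height u)
         (parent-unique : ∀ {u v w} → A ⊢ u ⟶ w → A ⊢ v ⟶ w → u ≡ v) where

  private
    Walk : List (Fin n) → Set
    Walk = Linked (SymClosure (A ⊢_⟶_))

  -- A non-backtracking walk that has once gone down can only continue down.
  fall : ∀ {v a b} xs → A ⊢ a ⟶ b → Walk (b ∷ (xs ∷ʳ v)) → Unique (v ∷ a ∷ b ∷ xs) →
         height v < height b × ∃ λ w → w ∈ₗ (b ∷ xs) × A ⊢ w ⟶ v
  fall [] e (fwd f ∷ [-]) _ = descending f , _ , here refl , f
  fall [] e (bwd f ∷ [-]) ((v≢a ∷ _) ∷ _) = contradiction (parent-unique f e) v≢a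
  fall (c ∷ xs) e (fwd f ∷ es) ((_ ∷ v≢) ∷ _ ∷ uniq)
    with below , w , w∈ , g ← fall xs f es (v≢ ∷ uniq) =
    ℕ.<-trans below (descending f) , w , there w∈ , g
  fall (c ∷ xs) e (bwd f ∷ es) (_ ∷ (_ ∷ a≢c ∷ _) ∷ _) =
    contradiction (parent-unique e f) a≢c

  -- A walk climbs until its first downward arc, and from there on `fall` applies. So either it
  -- climbs all the way to `v`, or its last arc points into `v`.
  climb : ∀ {v b} xs → Walk (b ∷ (xs ∷ʳ v)) → Unique (v ∷ b ∷ xs) →
          height b < height v ⊎ ∃ λ w → w ∈ₗ (b ∷ xs) × A ⊢ w ⟶ v
  climb [] (fwd f ∷ [-]) _ = inj₂ (_ , here refl , f)
  climb [] (bwd f ∷ [-]) _ = inj₁ (descending f)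
  climb (c ∷ xs) (fwd f ∷ es) uniq with _ , w , w∈ , g ← fall xs f es uniq =
    inj₂ (w , there w∈ , g)
  climb (c ∷ xs) (bwd f ∷ es) ((_ ∷ v≢) ∷ _ ∷ uniq) with climb xs es (v≢ ∷ uniq)
  ... | inj₁ below        = inj₁ (ℕ.<-trans (descending f) below)
  ... | inj₂ (w , w∈ , g) = inj₂ (w , there w∈ , g)

  -- Split by the directions of the first two edges. Down-down falls forever and cannot return to
  -- the height of `v`; down-up gives `y` two parents. After up-down the walk comes back to `v` from
  -- a second parent besides `y`. After up-up it either ends with such a second parent too, or
  -- climbs throughout and ends too high.
  forest-acyclic : ¬ HasUndirectedCycle A
  forest-acyclic (v , [] , () , _)
  forest-acyclic (v , _ ∷ [] , s≤s () , _)
  forest-acyclic (v , y ∷ z ∷ ws , _ , uniq , fwd e ∷ fwd f ∷ es) =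
    ℕ.<-asym (ℕ.<-trans (proj₁ (fall ws f es uniq)) (descending f)) (descending e)
  forest-acyclic (v , y ∷ z ∷ ws , _ , (_ ∷ v≢z ∷ _) ∷ _ , fwd e ∷ bwd f ∷ es) =
    v≢z (parent-unique e f)
  forest-acyclic (v , y ∷ z ∷ ws , _ , uniq@(_ ∷ y≢ ∷ _) , bwd e ∷ fwd f ∷ es)
    with _ , w , w∈ , g ← fall ws f es uniq =
    All.lookup y≢ w∈ (parent-unique e g)
  forest-acyclic (v , y ∷ z ∷ ws , _ , (_ ∷ v≢) ∷ y≢ ∷ uniq , bwd e ∷ bwd f ∷ es)
    with climb ws es (v≢ ∷ uniq)
  ... | inj₁ below        = ℕ.<-asym (ℕ.<-trans (descending e) (descending f)) below
  ... | inj₂ (w , w∈ , g) = All.lookup y≢ w∈ (parent-unique e g)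

module Construction (k : ℕ) where

  -- The digraph `H`.

  t order : ℕ
  t = 4 + k
  order = suc (t * t)

  -- nothing is the hub r; just (p , i) is the vertex of the p-th path
  -- at distance i from the end of that path.
  Vertex : Set
  Vertex = Maybe (Fin t × Fin t)

  decode : Fin order → Vertex
  decode zero    = nothing
  decode (suc x) = just (remQuot t x)

  encode : Vertex → Fin order
  encode nothing        = zero
  encode (just (p , i)) = suc (combine p i)

  decode-encode : ∀ v → decode (encode v) ≡ v
  decode-encode nothing        = refl
  decode-encode (just (p , i)) = cong just (Fin.remQuot-combine p i)

  encode-decode : ∀ x → encode (decode x) ≡ x
  encode-decode zero    = refl
  encode-decode (suc x) = cong suc (Fin.combine-remQuot {t} t x)

  encode-injective : ∀ {u v} → encode u ≡ encode v → u ≡ v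
  encode-injective eq = trans (sym (decode-encode _)) (trans (cong decode eq) (decode-encode _))

  decode-injective : ∀ {x y} → decode x ≡ decode y → x ≡ y
  decode-injective eq = trans (sym (encode-decode _)) (trans (cong encode eq) (encode-decode _))

  infix 4 _↝_ _↝?_ _⇝_ _⇝?_

  -- Positions decrease along a path: i = j + 1 is its forward arc and i < j a
  -- backward arc; the 3 makes the last four positions completely joined.
  _↝_ : Vertex → Vertex → Set
  nothing      ↝ nothing      = ⊥
  nothing      ↝ just (_ , j) = suc (toℕ j) ≡ t
  just (_ , i) ↝ nothing      = toℕ i ≡ 0
  just (p , i) ↝ just (q , j) = p ≡ q × i ≢ j × toℕ i ≤ 3 ⊔ suc (toℕ j)

  _↝?_ : B.Decidable _↝_
  nothing      ↝? nothing      = no id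
  nothing      ↝? just (_ , j) = suc (toℕ j) ℕ.≟ t
  just (_ , i) ↝? nothing      = toℕ i ℕ.≟ 0
  just (p , i) ↝? just (q , j) =
    p Fin.≟ q ×-dec ¬? (i Fin.≟ j) ×-dec toℕ i ℕ.≤? 3 ⊔ suc (toℕ j)

  ↝-irrefl : ∀ v → ¬ (v ↝ v)
  ↝-irrefl nothing  ()
  ↝-irrefl (just _) (_ , i≢i , _) = i≢i refl

  H : Digraph order
  H = record { arcs     = relArcs (λ x y → decode x ↝? decode y)
             ; loopless = λ x e → ↝-irrefl (decode x) (relArcs⁻ _ e) }

  H⁻ : ∀ {x y} → arcs H ⊢ x ⟶ y → decode x ↝ decode y
  H⁻ = relArcs⁻ _

  H⁺ : ∀ {x y} → decode x ↝ decode y → arcs H ⊢ x ⟶ y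
  H⁺ = relArcs⁺ _

  -- The spider, an explicit out-branching of `H`.

  -- An out-branching of H with at least one leaf: the hub and the bare paths.
  _⇝_ : Vertex → Vertex → Set
  _            ⇝ nothing      = ⊥
  nothing      ⇝ just (_ , j) = suc (toℕ j) ≡ t
  just (p , i) ⇝ just (q , j) = p ≡ q × toℕ i ≡ suc (toℕ j)

  _⇝?_ : B.Decidable _⇝_
  nothing      ⇝? nothing      = no id
  just _       ⇝? nothing      = no id
  nothing      ⇝? just (_ , j) = suc (toℕ j) ℕ.≟ t
  just (p , i) ⇝? just (q , j) = p Fin.≟ q ×-dec toℕ i ℕ.≟ suc (toℕ j)

  ⇝⇒↝ : ∀ u v → u ⇝ v → u ↝ v
  ⇝⇒↝ nothing  (just _) e = e
  ⇝⇒↝ (just (p , i)) (just (q , j)) (p≡q , i≡1+j) =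
    p≡q , (λ i≡j → ℕ.1+n≢n (trans (sym i≡1+j) (cong toℕ i≡j))) ,
    ℕ.≤-trans (ℕ.≤-reflexive i≡1+j) (ℕ.m≤n⊔m 3 _)

  parent : ∀ a → ∃ λ u → u ⇝ just a
  parent (p , j) with suc (toℕ j) ℕ.≟ t
  ... | yes last = nothing , last
  ... | no ¬last = just (p , Fin.fromℕ< 1+j<t) , refl , Fin.toℕ-fromℕ< 1+j<t
    where
    1+j<t : suc (toℕ j) < t
    1+j<t = ℕ.≤∧≢⇒< (Fin.toℕ<n j) ¬last

  -- The value `t` at the hub continues the count along each path, whose start has position `t - 1`;
  -- thus every arc of the spider descends by exactly one.
  height : Vertex → ℕ
  height nothing        = t
  height (just (_ , i)) = toℕ i

  ⇝⇒height : ∀ u v → u ⇝ v → height u ≡ suc (height v)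
  ⇝⇒height nothing  (just _) e       = sym e
  ⇝⇒height (just _) (just _) (_ , e) = e

  ⇝-unique : ∀ u v w → u ⇝ w → v ⇝ w → u ≡ v
  ⇝-unique nothing nothing (just _) _ _ = refl
  ⇝-unique nothing (just (_ , i)) (just _) e (_ , f) =
    contradiction (trans f e) (ℕ.<⇒≢ (Fin.toℕ<n i))
  ⇝-unique (just (_ , i)) nothing (just _) (_ , f) e =
    contradiction (trans f e) (ℕ.<⇒≢ (Fin.toℕ<n i))
  ⇝-unique (just (p , i)) (just (q , j)) (just _) (refl , e) (refl , f) =
    cong (λ l → just (p , l)) (Fin.toℕ-injective (trans e (sym f)))

  spider : Arcs order
  spider = relArcs (λ x y → decode x ⇝? decode y)

  spider⁻ : ∀ {x y} → spider ⊢ x ⟶ y → decode x ⇝ decode y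
  spider⁻ = relArcs⁻ _

  spider⁺ : ∀ {x y} → decode x ⇝ decode y → spider ⊢ x ⟶ y
  spider⁺ = relArcs⁺ _

  spider-descending : ∀ {x y} → spider ⊢ x ⟶ y → height (decode y) < height (decode x)
  spider-descending e = ℕ.≤-reflexive (sym (⇝⇒height _ _ (spider⁻ e)))

  -- Induction on a bound `m` for how far `x` lies below the hub: passing to the parent raises the
  -- height by one, and only the hub has height `t`.
  spider-fromHub : ∀ m x → t ≤ m + height (decode x) → Star (spider ⊢_⟶_) zero x
  spider-fromHub m zero long = ε
  spider-fromHub zero (suc x) long = contradiction (Fin.toℕ<n _) (ℕ.≤⇒≯ long)
  spider-fromHub (suc m) (suc x) long with parent (remQuot t x)
  ... | u , e = spider-fromHub m (encode u) long′ ◅◅ spider⁺ e′ ◅ ε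
    where
    e′ : decode (encode u) ⇝ decode (suc x)
    e′ = subst (_⇝ just (remQuot t x)) (sym (decode-encode u)) e
    long′ : t ≤ m + height (decode (encode u))
    long′ rewrite ⇝⇒height _ _ e′ | ℕ.+-suc m (height (decode (suc x))) = long

  spider-reach : ∀ x → Star (spider ⊢_⟶_) zero x
  spider-reach x = spider-fromHub t x (ℕ.m≤m+n t _)

  spiderTree : Subgraph order
  spiderTree = subgraph Subset.⊤ spider

  spider-isOutBranching : IsOutBranching H spiderTree
  spider-isOutBranching = record
    { outTree = record
      { subdigraph   = λ _ _ e → ∈⊤ , ∈⊤ , H⁺ (⇝⇒↝ _ _ (spider⁻ e))
      ; orientedTree = record
        { oriented  = λ _ _ e f → ℕ.<-asym (spider-descending e) (spider-descending f)
        ; connected = λ x y _ _ →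
            EqClosure.symmetric _ (gmap id fwd (spider-reach x)) ◅◅ gmap id fwd (spider-reach y)
        ; acyclic   = forest-acyclic {A = spider} (height ∘ decode) spider-descending
            (λ e f → decode-injective (⇝-unique _ _ _ (spider⁻ e) (spider⁻ f)))
        }
      ; root = zero , (∈⊤ , hub-inDegree) , λ {x} (_ , indeg) → hub-unique x indeg
      }
    ; spanning = refl
    }
    where
    hub-inDegree : inDegree spider zero ≡ 0
    hub-inDegree with inDegree spider zero ℕ.≟ 0
    ... | yes eq = eq
    ... | no  ≢0 with x , x∈ ← ∣p∣≢0⇒nonempty ≢0 =
      ⊥-elim (spider⁻ (∈-inNeighbours⁻ spider {x} x∈))

    hub-unique : ∀ x → inDegree spider x ≡ 0 → zero ≡ x
    hub-unique zero    _ = refl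
    hub-unique (suc x) indeg with u , e ← parent (remQuot t x) =
      contradiction indeg (ℕ.>⇒≢ (x∈p⇒0<∣p∣ (∈-inNeighbours⁺ spider
        (spider⁺ {encode u} {suc x} (subst (_⇝ _) (sym (decode-encode u)) e)))))

  spider-hasLeaf : 0 < numLeaves spiderTree
  spider-hasLeaf = x∈p⇒0<∣p∣ (∈-tabulate⁺ (isLeaf? spiderTree) {end} (∈⊤ , end-outDegree))
    where
    end : Fin order
    end = encode (just (0F , 0F))

    end-sink : ∀ v → ¬ (just (0F , 0F) ⇝ v)
    end-sink (just _) (_ , ())

    end-outDegree : outDegree spider end ≡ 0
    end-outDegree with outDegree spider end ℕ.≟ 0
    ... | yes eq = eq
    ... | no  ≢0 with x , x∈ ← ∣p∣≢0⇒nonempty ≢0 =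
      contradiction (subst (_⇝ decode x) (decode-encode (just (0F , 0F))) (spider⁻ x∈))
                    (end-sink (decode x))

  -- Strong connectivity.

  toHub : ∀ m p i → toℕ i ≡ m → Star _↝_ (just (p , i)) nothing
  toHub zero    p i i≡0 = i≡0 ◅ ε
  toHub (suc m) p (suc i) i≡1+m =
    (refl , (λ eq → ℕ.1+n≢n (trans (cong toℕ eq) (Fin.toℕ-inject₁ i))) ,
      ℕ.≤-trans (ℕ.≤-reflexive (cong suc (sym (Fin.toℕ-inject₁ i)))) (ℕ.m≤n⊔m 3 _)) ◅
    toHub m p (Fin.inject₁ i) (trans (Fin.toℕ-inject₁ i) (ℕ.suc-injective i≡1+m))

  vertexToHub : ∀ v → Star _↝_ v nothing
  vertexToHub nothing        = ε
  vertexToHub (just (p , i)) = toHub (toℕ i) p i refl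

  -- Every route goes through the hub: forward arcs lead to it, and the arcs of the spider lead from
  -- it to every vertex.
  H-strong : Strong H
  H-strong x y = reach x y , reach y x
    where
    encode-arc : ∀ {u v} → u ↝ v → arcs H ⊢ encode u ⟶ encode v
    encode-arc e = H⁺ (subst₂ _↝_ (sym (decode-encode _)) (sym (decode-encode _)) e)

    reach : ∀ x y → Star (arcs H ⊢_⟶_) x y
    reach x y =
      subst (λ z → Star (arcs H ⊢_⟶_) z zero) (encode-decode x)
        (gmap encode encode-arc (vertexToHub (decode x)))
      ◅◅ gmap id (λ e → H⁺ (⇝⇒↝ _ _ (spider⁻ e))) (spider-reach y)

  -- Minimum in-degree.

  length≤inDegree : ∀ x us → Unique us → All (_↝ decode x) us → length us ≤ inDegree (arcs H) x
  length≤inDegree x us uniq into =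
    subst (_≤ inDegree (arcs H) x) (length-map encode us)
      (length≤∣p∣ (Unique.map⁺ encode-injective uniq)
        (All.map⁺ (All.map (λ e → ∈-inNeighbours⁺ (arcs H)
          (H⁺ (subst (_↝ decode x) (sym (decode-encode _)) e))) into)))

  -- A vertex at position at most 3 has an arc to every other vertex of its path, so three of these
  -- four positions always serve. The hub is entered from the ends of three different paths.
  threePredecessors : ∀ v → ∃ λ us → length us ≡ 3 × Unique us × All (_↝ v) us
  threePredecessors nothing =
    just (0F , 0F) ∷ just (1F , 0F) ∷ just (2F , 0F) ∷ [] , refl ,
    ((λ ()) ∷ (λ ()) ∷ []) ∷ ((λ ()) ∷ []) ∷ [] ∷ [] , refl ∷ refl ∷ refl ∷ []
  threePredecessors (just (p , 0F)) =
    just (p , 1F) ∷ just (p , 2F) ∷ just (p , 3F) ∷ [] , refl ,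
    ((λ ()) ∷ (λ ()) ∷ []) ∷ ((λ ()) ∷ []) ∷ [] ∷ [] ,
    (refl , (λ ()) , s≤s z≤n) ∷ (refl , (λ ()) , s≤s (s≤s z≤n)) ∷
      (refl , (λ ()) , s≤s (s≤s (s≤s z≤n))) ∷ []
  threePredecessors (just (p , 1F)) =
    just (p , 0F) ∷ just (p , 2F) ∷ just (p , 3F) ∷ [] , refl ,
    ((λ ()) ∷ (λ ()) ∷ []) ∷ ((λ ()) ∷ []) ∷ [] ∷ [] ,
    (refl , (λ ()) , z≤n) ∷ (refl , (λ ()) , s≤s (s≤s z≤n)) ∷
      (refl , (λ ()) , s≤s (s≤s (s≤s z≤n))) ∷ []
  threePredecessors (just (p , 2F)) =
    just (p , 0F) ∷ just (p , 1F) ∷ just (p , 3F) ∷ [] , refl ,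
    ((λ ()) ∷ (λ ()) ∷ []) ∷ ((λ ()) ∷ []) ∷ [] ∷ [] ,
    (refl , (λ ()) , z≤n) ∷ (refl , (λ ()) , s≤s z≤n) ∷
      (refl , (λ ()) , s≤s (s≤s (s≤s z≤n))) ∷ []
  threePredecessors (just (p , suc (suc (suc i)))) =
    just (p , 0F) ∷ just (p , 1F) ∷ just (p , 2F) ∷ [] , refl ,
    ((λ ()) ∷ (λ ()) ∷ []) ∷ ((λ ()) ∷ []) ∷ [] ∷ [] ,
    (refl , (λ ()) , z≤n) ∷ (refl , (λ ()) , s≤s z≤n) ∷
      (refl , (λ ()) , s≤s (s≤s z≤n)) ∷ []

  inDegree≥3 : ∀ x → 3 ≤ inDegree (arcs H) x
  inDegree≥3 x with us , length≡3 , uniq , into ← threePredecessors (decode x) =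
    subst (_≤ inDegree (arcs H) x) length≡3 (length≤inDegree x us uniq into)

  -- At position 0 the bound `3 ⊔ 1` is 3, which leaves just the positions 1, 2 and 3 of the same
  -- path; the hub enters a path only at position `t - 1`, which is not 0.
  end-inDegree : inDegree (arcs H) (encode (just (0F , 0F))) ≡ 3
  end-inDegree = ℕ.≤-antisym
    (∣p∣≤length (map encode predecessors)
      (λ {x} x∈ → subst (_∈ₗ map encode predecessors) (encode-decode x) (∈-map⁺ encode
        (into-end (decode x) (subst (decode x ↝_) (decode-encode (just (0F , 0F)))
          (H⁻ (∈-inNeighbours⁻ (arcs H) x∈)))))))
    (inDegree≥3 (encode (just (0F , 0F))))
    where
    predecessors : List Vertex
    predecessors = just (0F , 1F) ∷ just (0F , 2F) ∷ just (0F , 3F) ∷ []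

    into-end : ∀ v → v ↝ just (0F , 0F) → v ∈ₗ predecessors
    into-end nothing ()
    into-end (just (p , 0F)) (refl , 0≢0 , _) = contradiction refl 0≢0
    into-end (just (p , 1F)) (refl , _) = here refl
    into-end (just (p , 2F)) (refl , _) = there (here refl)
    into-end (just (p , 3F)) (refl , _) = there (there (here refl))
    into-end (just (p , suc (suc (suc (suc i))))) (_ , _ , s≤s (s≤s (s≤s ())))

  -- The upper bound on the number of leaves.

  Beyond : Fin t → Fin t → Vertex → Set
  Beyond p i nothing        = ⊥
  Beyond p i (just (q , j)) = p ≡ q × toℕ j < toℕ i

  -- For i ≥ 3, deleting the vertex (p , i) cuts off the part of the path beyond it.
  beyond-entry : ∀ {p i} → 3 ≤ toℕ i → ∀ u v → Beyond p i v → u ↝ v →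
                 u ≡ just (p , i) ⊎ Beyond p i u
  beyond-entry {i = i} 3≤i nothing (just (q , j)) (_ , j<i) 1+j≡t =
    contradiction 1+j≡t (ℕ.<⇒≢ (ℕ.≤-<-trans j<i (Fin.toℕ<n i)))
  beyond-entry {p} {i} 3≤i (just (q , l)) (just (_ , j)) (refl , j<i) (refl , _ , l≤)
    with l Fin.≟ i
  ... | yes refl = inj₁ refl
  ... | no  l≢i  = inj₂ (refl , ℕ.≤∧≢⇒< (ℕ.≤-trans l≤ (ℕ.⊔-lub 3≤i j<i)) (l≢i ∘ Fin.toℕ-injective))

  pathOf : Vertex → List Vertex
  pathOf nothing        = []
  pathOf (just (p , _)) = map (λ i → just (p , i)) (allFin t)

  ends : List Vertex
  ends = cartesianProductWith (λ i p → just (p , i)) (0F ∷ 1F ∷ 2F ∷ []) (allFin t)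

  ∈-ends : ∀ {i} p → i ∈ₗ 0F ∷ 1F ∷ 2F ∷ [] → just (p , i) ∈ₗ ends
  ∈-ends p i∈ = ∈-cartesianProductWith⁺ (λ i p → just (p , i)) i∈ (∈-allFin p)

  leafCandidates : Vertex → List Vertex
  leafCandidates r = nothing ∷ pathOf r ++ ends

  length-candidates : ∀ r → length (leafCandidates r) ≤ 5 * t
  -- The hub is charged `t` instead of 1, the path of the root at most `t`, and the three last
  -- positions of all paths `3 * t`; this is where the constant 5 comes from.
  length-candidates r = ℕ.+-mono-≤ {1} {t} (s≤s z≤n)
    (ℕ.≤-trans (ℕ.≤-reflexive (length-++ (pathOf r)))
      (ℕ.+-mono-≤ (pathOf≤ r) (ℕ.≤-reflexive ends≡)))
    where
    row : ∀ (f : Fin t → Vertex) → length (map f (allFin t)) ≡ t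
    row f = trans (length-map f (allFin t)) (length-tabulate id)

    pathOf≤ : ∀ r → length (pathOf r) ≤ t
    pathOf≤ nothing  = z≤n
    pathOf≤ (just (p , _)) = ℕ.≤-reflexive (row (λ i → just (p , i)))

    layers : ∀ (is : List (Fin t)) →
             length (cartesianProductWith (λ i p → just (p , i)) is (allFin t)) ≡ length is * t
    layers []       = refl
    layers (i ∷ is) = trans (length-++ (map (λ p → just (p , i)) (allFin t)))
      (subst₂ (λ a b → a + b ≡ t + length is * t) (sym (row _)) (sym (layers is)) refl)

    ends≡ : length ends ≡ 3 * t
    ends≡ = layers (0F ∷ 1F ∷ 2F ∷ [])

  module _ (T : Subgraph order) (branching : IsOutBranching H T) where

    open IsOutBranching branching
    open IsOutTree outTree
    open IsOrientedTree orientedTree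

    treeRoot : Fin order
    treeRoot = proj₁ root

    hasParent : ∀ {x} → x ≢ treeRoot → ∃ λ u → A T ⊢ u ⟶ x
    hasParent {x} x≢r
      with u , u∈ ← ∣p∣≢0⇒nonempty {p = inNeighbours (A T) x} (λ indeg →
             x≢r (sym (proj₂ (proj₂ root) (subst (x ∈_) (sym spanning) ∈⊤ , indeg)))) =
      u , ∈-inNeighbours⁻ (A T) u∈

    leaf-noArc : ∀ {x y} → x ∈ leaves T → ¬ (A T ⊢ x ⟶ y)
    leaf-noArc x∈ e = ℕ.>⇒≢ (x∈p⇒0<∣p∣ e) (proj₂ (∈-tabulate⁻ (isLeaf? T) x∈))

    -- If the root is off the path, every vertex beyond the leaf `x` has a parent, which by
    -- `beyond-entry` is again beyond `x` or is `x` itself. A leaf is nobody's parent, so the part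
    -- beyond `x` is closed under parents and contains a cycle. The argument is by contradiction,
    -- hence the double negation.
    root-onPath : ∀ {x p} {i : Fin (suc k)} → x ∈ leaves T →
                  decode x ≡ just (p , suc (suc (suc i))) →
                  ¬ ¬ ∃ λ j → decode treeRoot ≡ just (p , j)
    root-onPath {x} {p} {i} x∈ x≡ off = acyclic (backwardClosed⇒cycle {A = A T}
      (λ v e → loopless H v (proj₂ (proj₂ (subdigraph v v e)))) oriented back
      -- The end of the path witnesses that the part beyond `x` is nonempty.
      {encode (just (p , 0F))} (subst (Beyond p _) (sym (decode-encode _)) (refl , s≤s z≤n)))
      where
      Q : Fin order → Set
      Q u = Beyond p (suc (suc (suc i))) (decode u)

      notRoot : ∀ v → Beyond p (suc (suc (suc i))) v → v ≢ decode treeRoot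
      notRoot (just (_ , j)) (refl , _) v≡r = off (j , sym v≡r)

      back : ∀ {v} → Q v → ∃ λ u → Q u × A T ⊢ u ⟶ v
      back {v} qv with hasParent (λ v≡r → notRoot (decode v) qv (cong decode v≡r))
      ... | u , e with beyond-entry (s≤s (s≤s (s≤s z≤n))) (decode u) (decode v) qv
                         (H⁻ (proj₂ (proj₂ (subdigraph u v e))))
      ...   | inj₂ qu = u , qu , e
      ...   | inj₁ u≡ = contradiction e
                (leaf-noArc (subst (_∈ leaves T) (decode-injective (trans x≡ (sym u≡))) x∈))

    leaf-candidate : ∀ {x} → x ∈ leaves T → decode x ∈ₗ leafCandidates (decode treeRoot)
    leaf-candidate {x} x∈ with decode x in eq
    ... | nothing = here refl
    ... | just (p , 0F) = there (∈-++⁺ʳ (pathOf (decode treeRoot)) (∈-ends p (here refl)))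
    ... | just (p , 1F) = there (∈-++⁺ʳ (pathOf (decode treeRoot)) (∈-ends p (there (here refl))))
    ... | just (p , 2F) =
      there (∈-++⁺ʳ (pathOf (decode treeRoot)) (∈-ends p (there (there (here refl)))))
    -- The double negation suffices here, because whether the root lies on path `p` is decidable.
    ... | just (p , suc (suc (suc i))) with decode treeRoot | root-onPath x∈ eq
    ...   | nothing | onPath = contradiction (λ ()) onPath
    ...   | just (q , j) | onPath with q Fin.≟ p
    ...     | yes refl = there (∈-++⁺ˡ (∈-map⁺ (λ l → just (q , l)) (∈-allFin _)))
    ...     | no  q≢p  = contradiction (λ { (_ , refl) → q≢p refl }) onPath

    numLeaves≤ : numLeaves T ≤ 5 * t
    numLeaves≤ = ℕ.≤-trans
      (∣p∣≤length (map encode (leafCandidates (decode treeRoot)))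
        (λ {x} x∈ → subst (_∈ₗ map encode (leafCandidates (decode treeRoot))) (encode-decode x)
          (∈-map⁺ encode (leaf-candidate x∈))))
      (ℕ.≤-trans (ℕ.≤-reflexive (length-map encode (leafCandidates (decode treeRoot))))
        (length-candidates (decode treeRoot)))

  ℓₛ-bounds : 0 < ℓₛ H × ℓₛ H ≤ 5 * t
  ℓₛ-bounds with ℓₛ H | ℓₛ-isMaxLeaves H
  ... | _ | inj₁ ((T , branching , refl) , max) =
    ℕ.<-≤-trans spider-hasLeaf (max spiderTree spider-isOutBranching) , numLeaves≤ T branching
  -- The default value 0 of `ℓₛ` is excluded by the spider.
  ... | _ | inj₂ (none , _) = contradiction (spiderTree , spider-isOutBranching) none

  construction : ∃ λ (H : Digraph order) → Strong H × HasMinInDegree H 3 × 0 < ℓₛ H × ℓₛ H ≤ 5 * t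
  construction = H , H-strong , (inDegree≥3 , _ , end-inDegree) , ℓₛ-bounds

theorem6 : ∃ λ (C : ℕ) → (t : ℕ) → 6 ≤ t →
    ∃ λ (H : Digraph (t ^ 2 + 1)) →
    Strong H × HasMinInDegree H 3 × 0 < ℓₛ H × ℓₛ H ≤ C * t
theorem6 = 5 , λ { t@(suc (suc (suc (suc k)))) (s≤s (s≤s (s≤s (s≤s _)))) →
  subst (λ n → ∃ λ (H : Digraph n) → Strong H × HasMinInDegree H 3 × 0 < ℓₛ H × ℓₛ H ≤ 5 * t)
    -- `t ^ 2` unfolds to `t * (t * 1)`, so the order `suc (t * t)` is transported to `t ^ 2 + 1`.
    (trans (ℕ.+-comm 1 (t * t)) (cong (λ m → t * m + 1) (sym (ℕ.*-identityʳ t))))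
    (Construction.construction k) }
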